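{- Let $\epsilon$ be a valuation, let $\mathbf p,\mathbf p_1,\mathbf p_2$ be expectation lower bounds (functions from valuations to $[0,1]$), let $\mathbf 0$ be the expectation lower bound that is constantly $0$, let $s$ be a pGCL program, and let $\varphi,\varphi_1,\varphi_2$ be well-formed pDL formulae. Then: 1. (Universal lower bound) $\epsilon\models[s]_{\mathbf 0}\,\varphi$. 2. (Quantitative weakening) If $\epsilon\models[s]_{\mathbf p_1}\,\varphi$ and $\mathbf p_2\le\mathbf p_1$ everywhere, then $\epsilon\models[s]_{\mathbf p_2}\,\varphi$. 3. (Weakening conjunctions) If $\epsilon\models[s]_{\mathbf p}\,(\varphi_1\wedge\varphi_2)$, then $\epsilon\models[s]_{\mathbf p}\,\varphi_i$ for $i=1,2$. 4. (Qualitative weakening) If $\epsilon\models[s]_{\mathbf p}\,\varphi_1$ and $\models\varphi_1\rightarrow\varphi_2$, then $\epsilon\models[s]_{\mathbf p}\,\varphi_2$.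
   Context: **Programs (pGCL).** Fix a set $X$ of program variables. Expressions $e$ are built from program variables and primitive values (Booleans, numbers, ...) with the usual unary/binary arithmetic, comparison and logical operators; they are assumed well-formed, and $\epsilon(e)$ denotes the value of $e$ in a valuation $\epsilon$ (a map from program variables to values). Programs are $$s ::= s\sqcap s \mid s\,{}_{e}\!\oplus s\mid s;s\mid \mathtt{skip}\mid x:=e\mid \mathtt{if}\ e\ \{s\}\ \mathtt{else}\ \{s\}\mid\mathtt{while}\ e\ \{s\},$$ where $\sqcap$ is demonic (non-deterministic) choice and ${}_e\oplus$ is probabilistic choice (left branch with probability given by the value of $e$). **MDP semantics.** A program $s$ denotes a Markov decision process $\mathcal M_s$ with states $\langle\epsilon,s'\rangle$ (valuation, program). A positional policy $\pi$ maps states to available actions; the only states with more than one action are those where a demonic choice is to be resolved, and $\pi\langle\epsilon,s_1\sqcap s_2\rangle\in\{s_1,s_2\}$. For a policy $\pi$, the probabilistic transitions $\sigma\xrightarrow{p}_\pi\sigma'$ are given by the rules: - $\langle\epsilon,x:=e\rangle\xrightarrow{1}_\pi\langle\epsilon[x\mapsto\epsilon(e)],\mathtt{skip}\rangle$; - if $\epsilon(e)=p\in[0,1]$: $\langle\epsilon,s_1\,{}_e\!\oplus s_2\rangle\xrightarrow{p}_\pi\langle\epsilon,s_1\rangle$ and $\langle\epsilon,s_1\,{}_e\!\oplus s_2\rangle\xrightarrow{1-p}_\pi\langle\epsilon,s_2\rangle$ (probabilities are added if the targets coincide); - if $\pi\langle\epsilon,s_1\sqcap s_2\rangle=s_i$: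 $\langle\epsilon,s_1\sqcap s_2\rangle\xrightarrow{1}_\pi\langle\epsilon,s_i\rangle$; - if $\langle\epsilon,s_1\rangle\xrightarrow{p}_\pi\langle\epsilon',s_2\rangle$: $\langle\epsilon,\mathtt{skip};s_1\rangle\xrightarrow{p}_\pi\langle\epsilon',s_2\rangle$ and $\langle\epsilon,s_1;s\rangle\xrightarrow{p}_\pi\langle\epsilon',s_2;s\rangle$; - $\langle\epsilon,\mathtt{if}\ e\ \{s_1\}\ \mathtt{else}\ \{s_2\}\rangle\xrightarrow{1}_\pi\langle\epsilon,s_1\rangle$ if $\epsilon(e)=\mathit{true}$, and $\xrightarrow{1}_\pi\langle\epsilon,s_2\rangle$ if $\epsilon(e)=\mathit{false}$; - $\langle\epsilon,\mathtt{while}\ e\ \{s\}\rangle\xrightarrow{1}_\pi\langle\epsilon,s;\mathtt{while}\ e\ \{s\}\rangle$ if $\epsilon(e)=\mathit{true}$, and $\xrightarrow{1}_\pi\langle\epsilon,\mathtt{skip}\rangle$ if $\epsilon(e)=\mathit{false}$. A state is final if it has no transitions; the state $\langle\epsilon,\mathtt{skip}\rangle$ is final. Standing assumption: every program considered (every program occurring inside a box) reaches, from every initial valuation and under every policy, a state of the form $\langle\epsilon',\mathtt{skip}\rangle$ with probability $1$. **Expectations.** A path is a finite sequence of states $\sigma_1,\dots,\sigma_n$ with consecutive positive-probability transitions under $\pi$ ending in a final state $\mathrm{final}(\overline\sigma)=\sigma_n$; $\Pr(\overline\sigma)$ is the product of its transition probabilities (equal to $1$ for a one-state path), and $\mathrm{paths}_\pi(\sigma)$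 is the set of paths from $\sigma$. For a reward $r$ with values in $[0,1]$ on final states, $$\mathbb E_{\sigma,\pi}\,r=\sum_{\overline\sigma\in\mathrm{paths}_\pi(\sigma)}\Pr(\overline\sigma)\,r(\mathrm{final}(\overline\sigma)),\qquad \mathbf E_\sigma\,r=\inf_\pi\mathbb E_{\sigma,\pi}\,r .$$ A function of valuations is regarded as a reward by evaluating it on the valuation of the final state. For program $s$ and valuation $\epsilon$, the expectation "from $\epsilon$ in $\mathcal M_s$" means $\mathbf E_{\langle\epsilon,s\rangle}$. **Logic (pDL).** Let $L$ be a set of logical variables disjoint from $X$; each $l\in L$ has a domain $\mathrm{dom}\,l$ of values. Formulae are $$\varphi::=\text{atomic formula}\mid\neg\varphi\mid\varphi_1\wedge\varphi_2\mid\forall l\cdot\varphi\mid[s]_{\mathbf p}\,\varphi,$$ where atomic formulae are built from constants, program variables and logical variables, $s$ is a pGCL program (it mentions no logical variables), and $\mathbf p$ is an expectation lower bound, i.e. a function from valuations of program variables to $[0,1]$. $\to,\vee,\exists$ are derived as usual. A formula is well-formed if it has no free logical variables. Satisfaction $\epsilon\models\varphi$ is defined by: standard satisfaction for atomic formulae; the classical clauses for $\neg,\wedge$; $\epsilon\models\forall l\cdot\varphi$ iff $\epsilon\models\varphi[l:=v]$ for each $v\in\mathrm{dom}\,l$; and $$\epsilon\models[s]_{\mathbf p}\,\varphi\quad\text{iff}\quad \mathbf p(\epsilon)\le\mathbf E_{\langle\epsilon,s\rangle}[\![\varphi]\!]\ \text{ in }\mathcal M_s,$$ where $[\![\varphi]\!](\epsilon')=1$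 if $\epsilon'\models\varphi$ and $0$ otherwise. $\models\varphi$ means $\epsilon\models\varphi$ for all valuations $\epsilon$. -}

module Defs where

open import Data.Bool using (Bool; true; false; T; if_then_else_)
open import Data.List using (List; []; _∷_; map; foldr; null)
open import Data.List.Membership.Propositional using (_∈_)
open import Data.List.Relation.Unary.All using (All; []; _∷_; lookup)
open import Data.List.Relation.Unary.Unique.Propositional using (Unique)
open import Data.Maybe using (Maybe; just; nothing)
open import Data.Product using (Σ; ∃; ∃₂; _×_; _,_; proj₁; proj₂)
open import Data.Rational as ℚ using (ℚ; 0ℚ; 1ℚ)
open import Data.Rational.Properties using (≤-<-trans; <-dense)
open import Data.Sum using (_⊎_; inj₁; inj₂)
open import Level using (0ℓ)
open import Relation.Binary.Definitions using (DecidableEquality)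
open import Relation.Binary.PropositionalEquality using (_≡_; refl)
open import Relation.Nullary using (¬_; yes; no)
open import Relation.Unary using (Pred)

infix  4 _<_ _≤_ _≈_
infixl 6 _+_
infixl 7 _*_

-- Non-negative extended reals as Dedekind (lower) cuts: x ∋ q says q < x.
-- With ∞ included, every supremum and every sum of non-negative terms
-- exists, so neither needs a proof of boundedness to be written down.
record [0,∞] : Set₁ where
  infix 4 _∋_
  field
    _∋_     : ℚ → Set
    neg     : ∀ {q} → q ℚ.< 0ℚ → _∋_ q
    down    : ∀ {q r} → q ℚ.≤ r → _∋_ r → _∋_ q
    rounded : ∀ {q} → _∋_ q → ∃ λ r → q ℚ.< r × _∋_ r

open [0,∞] public using (_∋_)

-- Classically x ≤ y is inclusion of cuts; as a negation it is ¬¬-stable, so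
-- satisfaction below obeys classical logic without assuming excluded middle.
_<_ _≤_ _≈_ : [0,∞] → [0,∞] → Set
x < y = ∃ λ q → y ∋ q × ¬ (x ∋ q)
x ≤ y = ¬ (y < x)
x ≈ y = x ≤ y × y ≤ x

-- The least element of [0,∞] above every rational in P.
sup : Pred ℚ 0ℓ → [0,∞]
sup P = record
  { _∋_     = λ q → q ℚ.< 0ℚ ⊎ ∃ λ r → q ℚ.< r × P r
  ; neg     = inj₁
  ; down    = λ { q≤r (inj₁ r<0)           → inj₁ (≤-<-trans q≤r r<0)
                ; q≤r (inj₂ (s , r<s , Ps)) → inj₂ (s , ≤-<-trans q≤r r<s , Ps) }
  ; rounded = λ { (inj₁ q<0) →
                    let m , q<m , m<0 = <-dense q<0 in m , q<m , inj₁ m<0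
                ; (inj₂ (s , q<s , Ps)) →
                    let m , q<m , m<s = <-dense q<s in m , q<m , inj₂ (s , m<s , Ps) }
  }

-- 1 if A holds, 0 otherwise.
𝟙 : Set → [0,∞]
𝟙 A = sup λ q → q ≡ 1ℚ × A

0# 1# : [0,∞]
0# = sup λ q → q ≡ 0ℚ
1# = sup λ q → q ≡ 1ℚ

_+_ _*_ : [0,∞] → [0,∞] → [0,∞]
x + y = sup λ q → ∃₂ λ r s → x ∋ r × y ∋ s × q ≡ r ℚ.+ s
x * y = sup λ q → ∃₂ λ r s →
          (0ℚ ℚ.≤ r × x ∋ r) × (0ℚ ℚ.≤ s × y ∋ s) × q ≡ r ℚ.* s

-- Truncated at 0; only used for x ≤ 1.
1-_ : [0,∞] → [0,∞]
1- x = sup λ q → ¬ (x ∋ (1ℚ ℚ.- q))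

⨆ ⨅ : {I : Set} → (I → [0,∞]) → [0,∞]
⨆ x = sup λ q → ∃ λ i → x i ∋ q
⨅ x = sup λ q → ∀ i → x i ∋ q

sum : List [0,∞] → [0,∞]
sum = foldr _+_ 0#

-- The sum of f over the (possibly infinite) set S: the supremum of the sums
-- over its finite subsets, listed without repetition.
∑ : {A : Set} (S : Pred A 0ℓ) → (A → [0,∞]) → [0,∞]
∑ {A} S f = ⨆ {Σ (List A) λ as → Unique as × All S as} λ (as , _) → sum (map f as)

[0,1] : Set₁
[0,1] = Σ [0,∞] (_≤ 1#)

0≤1 : 0# ≤ 1#
0≤1 (q , inj₁ q<0 , q∉1)             = q∉1 (inj₁ q<0)
0≤1 (q , inj₂ (_ , q<0 , refl) , q∉1) = q∉1 (inj₁ q<0)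

data Sort (Base : Set) : Set where
  bool number : Sort Base
  base        : Base → Sort Base

Value : {Base : Set} → (Base → Set) → Set → Sort Base → Set
Value V Number bool     = Bool
Value V Number number   = Number
Value V Number (base b) = V b

-- What is fixed once and for all: the program and logical variables, the
-- primitive values and the operators on them.  Sorting makes every expression
-- well-formed.
record Language : Set₁ where
  field
    Base   : Set
    ⟦_⟧ᵇ   : Base → Set
    Number : Set
    -- The number as a probability, if it lies in [0,1].
    probability : Number → Maybe [0,1]

  ⟦_⟧ : Sort Base → Set
  ⟦_⟧ = Value ⟦_⟧ᵇ Number

  field
    Op₁  : Sort Base → Sort Base → Set
    Op₂  : Sort Base → Sort Base → Sort Base → Set
    ⟦_⟧₁ : ∀ {τ υ} → Op₁ τ υ → ⟦ τ ⟧ → ⟦ υ ⟧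
    ⟦_⟧₂ : ∀ {τ τ′ υ} → Op₂ τ τ′ υ → ⟦ τ ⟧ → ⟦ τ′ ⟧ → ⟦ υ ⟧

    X     : Set
    _≟_   : DecidableEquality X
    sortX : X → Sort Base

    L     : Set
    sortL : L → Sort Base
    dom   : (l : L) → Pred ⟦ sortL l ⟧ 0ℓ

module pDL (𝓛 : Language) where
  open Language 𝓛

  infix  4 _⊨_⟨_⟩ _⊨_ ⊨_
  infixr 5 _⨾_ _⊓_
  infix  6 _≔_
  infixr 5 _⇒_
  infixr 6 _∧_

  -- Γ lists the logical variables that may occur free.
  data Expr (Γ : List L) : Sort Base → Set where
    val  : ∀ {τ} → ⟦ τ ⟧ → Expr Γ τ
    var  : (x : X) → Expr Γ (sortX x)
    lvar : ∀ {l} → l ∈ Γ → Expr Γ (sortL l)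
    op₁  : ∀ {τ υ} → Op₁ τ υ → Expr Γ τ → Expr Γ υ
    op₂  : ∀ {τ τ′ υ} → Op₂ τ τ′ υ → Expr Γ τ → Expr Γ τ′ → Expr Γ υ

  Valuation : Set
  Valuation = (x : X) → ⟦ sortX x ⟧

  _[_↦_] : Valuation → (x : X) → ⟦ sortX x ⟧ → Valuation
  (ε [ x ↦ v ]) y with x ≟ y
  ... | yes refl = v
  ... | no  _    = ε y

  eval : ∀ {τ} → Valuation → Expr [] τ → ⟦ τ ⟧
  eval ε (val v)      = v
  eval ε (var x)      = ε x
  eval ε (op₁ o e)    = ⟦ o ⟧₁ (eval ε e)
  eval ε (op₂ o e e′) = ⟦ o ⟧₂ (eval ε e) (eval ε e′)

  data Program : Set where
    _⊓_           : Program → Program → Program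
    _⊕⟨_⟩_        : Program → Expr [] number → Program → Program
    _⨾_           : Program → Program → Program
    skip          : Program
    _≔_           : (x : X) → Expr [] (sortX x) → Program
    If_Then_Else_ : Expr [] bool → Program → Program → Program
    While_Do_     : Expr [] bool → Program → Program

  State : Set
  State = Valuation × Program

  -- A policy only has a choice to make at ⟨ε, s₁ ⊓ s₂⟩.
  Policy : Set
  Policy = Valuation → (s₁ s₂ : Program) → ∃ λ s → s ≡ s₁ ⊎ s ≡ s₂

  module _ (π : Policy) where

    -- The transitions derivable from a state, one entry per derivation.
    -- skip itself has none, so the second sequencing rule never applies to
    -- skip ⨾ s; in particular skip ⨾ skip is stuck.
    step : Valuation → Program → List ([0,∞] × State)
    step ε (s₁ ⊓ s₂) = (1# , ε , proj₁ (π ε s₁ s₂)) ∷ []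
    step ε (s₁ ⊕⟨ e ⟩ s₂) with probability (eval ε e)
    ... | just (p , _) = (p , ε , s₁) ∷ (1- p , ε , s₂) ∷ []
    ... | nothing      = []
    step ε (skip ⨾ s) = step ε s
    step ε (s₁ ⨾ s) = map (λ (p , ε′ , s₂) → p , ε′ , s₂ ⨾ s) (step ε s₁)
    step ε skip = []
    step ε (x ≔ e) = (1# , ε [ x ↦ eval ε e ] , skip) ∷ []
    step ε (If e Then s₁ Else s₂) =
      (1# , ε , (if eval ε e then s₁ else s₂)) ∷ []
    step ε (While e Do s) =
      (1# , ε , (if eval ε e then s ⨾ (While e Do s) else skip)) ∷ []

    Final : State → Set
    Final (ε , s) = T (null (step ε s))

    -- Probabilities of transitions with the same target are added.
    P[_⟶_] : State → State → [0,∞]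
    P[ (ε , s) ⟶ σ′ ] = sum (map (λ (p , τ) → p * 𝟙 (τ ≡ σ′)) (step ε s))

    -- A path from σ is represented by the list of the states after σ.
    paths : State → Pred (List State) 0ℓ
    paths σ []       = Final σ
    paths σ (σ′ ∷ σs) = 0# < P[ σ ⟶ σ′ ] × paths σ′ σs

    Pr : State → List State → [0,∞]
    Pr σ []        = 1#
    Pr σ (σ′ ∷ σs) = P[ σ ⟶ σ′ ] * Pr σ′ σs

  final : State → List State → State
  final σ []        = σ
  final σ (σ′ ∷ σs) = final σ′ σs

  𝔼[_,_] : State → Policy → (State → [0,∞]) → [0,∞]
  𝔼[ σ , π ] r = ∑ (paths π σ) λ σs → Pr π σ σs * r (final σ σs)

  𝐄[_] : State → (State → [0,∞]) → [0,∞]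
  𝐄[ σ ] r = ⨅ λ (π : Policy) → 𝔼[ σ , π ] r

  AlmostSurelyTerminating : Program → Set
  AlmostSurelyTerminating s =
    ∀ ε π → 𝔼[ (ε , s) , π ] (λ (_ , s′) → 𝟙 (s′ ≡ skip)) ≈ 1#

  -- The programs allowed inside a box.
  record TerminatingProgram : Set where
    constructor _terminating_
    field
      program     : Program
      terminating : AlmostSurelyTerminating program

  open TerminatingProgram public

  LowerBound : Set₁
  LowerBound = Valuation → [0,1]

  _≤ᵇ_ : LowerBound → LowerBound → Set
  p ≤ᵇ p′ = ∀ ε → proj₁ (p ε) ≤ proj₁ (p′ ε)

  𝟎 : LowerBound
  𝟎 _ = 0# , 0≤1

  data Form (Γ : List L) : Set₁ where
    atom   : Expr Γ bool → Form Γ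
    ∼_     : Form Γ → Form Γ
    _∧_    : Form Γ → Form Γ → Form Γ
    all    : (l : L) → Form (l ∷ Γ) → Form Γ
    [_]_·_ : TerminatingProgram → LowerBound → Form Γ → Form Γ

  WellFormed : Set₁
  WellFormed = Form []

  _⇒_ : ∀ {Γ} → Form Γ → Form Γ → Form Γ
  φ ⇒ ψ = ∼ (φ ∧ ∼ ψ)

  Substitution : List L → Set
  Substitution = All (λ l → ⟦ sortL l ⟧)

  _[_] : ∀ {Γ τ} → Expr Γ τ → Substitution Γ → Expr [] τ
  val v      [ ρ ] = val v
  var x      [ ρ ] = var x
  lvar l∈Γ   [ ρ ] = val (lookup ρ l∈Γ)
  op₁ o e    [ ρ ] = op₁ o (e [ ρ ])
  op₂ o e e′ [ ρ ] = op₂ o (e [ ρ ]) (e′ [ ρ ])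

  -- ε ⊨ φ ⟨ ρ ⟩ is satisfaction of the instance of φ under ρ.  The
  -- substitutions [l := v] are collected in ρ and carried out at the atoms,
  -- which makes the definition structurally recursive.
  _⊨_⟨_⟩ : ∀ {Γ} → Valuation → Form Γ → Substitution Γ → Set
  ε ⊨ atom e ⟨ ρ ⟩      = eval ε (e [ ρ ]) ≡ true
  ε ⊨ ∼ φ ⟨ ρ ⟩         = ¬ (ε ⊨ φ ⟨ ρ ⟩)
  ε ⊨ φ ∧ ψ ⟨ ρ ⟩       = ε ⊨ φ ⟨ ρ ⟩ × ε ⊨ ψ ⟨ ρ ⟩
  ε ⊨ all l φ ⟨ ρ ⟩     = ∀ v → dom l v → ε ⊨ φ ⟨ v ∷ ρ ⟩
  ε ⊨ [ s ] p · φ ⟨ ρ ⟩ =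
    proj₁ (p ε) ≤ 𝐄[ ε , program s ] (λ (ε′ , _) → 𝟙 (ε′ ⊨ φ ⟨ ρ ⟩))

  _⊨_ : Valuation → WellFormed → Set
  ε ⊨ φ = ε ⊨ φ ⟨ [] ⟩

  ⊨_ : WellFormed → Set
  ⊨ φ = ∀ ε → ε ⊨ φ

{-# OPTIONS --safe #-}
module Submission where

-- Everything rests on 𝐄 being monotone in the reward.  Monotonicity is proved
-- for inclusion of cuts, which is stronger than ≤: as ≤ is a negation, the
-- infimum over policies would need a double-negation shift.  Inclusion suffices
-- because satisfaction is ¬¬-stable, so that a valid φ₁ ⇒ φ₂, which only says
-- that φ₁ excludes ¬ φ₂, gives a genuine implication.

open import Defs
open import Data.Bool.Properties as Bool using ()
open import Data.List using (List; []; _∷_; map)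
open import Data.Product using (_×_; _,_; proj₁; proj₂; map₂)
open import Data.Rational using (ℚ)
open import Data.Sum using (inj₁; inj₂) renaming (map₂ to ⊎-map₂)
open import Function using (id; _∘_)
open import Level using (0ℓ)
open import Relation.Binary.PropositionalEquality using (refl)
open import Relation.Nullary.Decidable using (decidable-stable)
open import Relation.Nullary.Negation using (Stable)
open import Relation.Unary using (Pred; _⊆_)

infix 4 _⊑_

_⊑_ : [0,∞] → [0,∞] → Set
x ⊑ y = (x ∋_) ⊆ (y ∋_)

≤-trans-⊑ : ∀ {x y z} → x ≤ y → y ⊑ z → x ≤ z
≤-trans-⊑ x≤y y⊑z (q , x∋q , z∌q) = x≤y (q , x∋q , z∌q ∘ y⊑z)

-- A witness `q` of `z < x` also witnesses `y < x`: were `q` in `y`, it would witness `z < y`.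
≤-trans : ∀ {x y z} → x ≤ y → y ≤ z → x ≤ z
≤-trans x≤y y≤z (q , x∋q , z∌q) = x≤y (q , x∋q , λ y∋q → y≤z (q , y∋q , z∌q))

-- Both ways of lying in `0#` amount to `q < 0`, and every cut contains the negative rationals.
0#-minimum : ∀ x → 0# ≤ x
0#-minimum x (q , inj₁ q<0 , x∌q)             = x∌q ([0,∞].neg x q<0)
0#-minimum x (q , inj₂ (_ , q<0 , refl) , x∌q) = x∌q ([0,∞].neg x q<0)

sup-mono : ∀ {P Q : Pred ℚ 0ℓ} → P ⊆ Q → sup P ⊑ sup Q
sup-mono P⊆Q = ⊎-map₂ (map₂ (map₂ P⊆Q))

𝟙-mono : ∀ {A B : Set} → (A → B) → 𝟙 A ⊑ 𝟙 B
𝟙-mono f = sup-mono (map₂ f)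

+-mono : ∀ {x x′ y y′} → x ⊑ x′ → y ⊑ y′ → x + y ⊑ x′ + y′
+-mono x⊑x′ y⊑y′ =
  sup-mono λ (r , s , x∋r , y∋s , q≡) → r , s , x⊑x′ x∋r , y⊑y′ y∋s , q≡

*-monoʳ : ∀ x {y y′} → y ⊑ y′ → x * y ⊑ x * y′
*-monoʳ x y⊑y′ =
  sup-mono λ (r , s , x∋r , (0≤s , y∋s) , q≡) → r , s , x∋r , (0≤s , y⊑y′ y∋s) , q≡

⨆-mono : ∀ {I : Set} {x y : I → [0,∞]} → (∀ i → x i ⊑ y i) → ⨆ x ⊑ ⨆ y
⨆-mono x⊑y = sup-mono λ (i , xi∋q) → i , x⊑y i xi∋q

⨅-mono : ∀ {I : Set} {x y : I → [0,∞]} → (∀ i → x i ⊑ y i) → ⨅ x ⊑ ⨅ y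
⨅-mono x⊑y = sup-mono λ x∋q i → x⊑y i (x∋q i)

sum-mono : ∀ {A : Set} {f g : A → [0,∞]} → (∀ a → f a ⊑ g a) →
           ∀ as → sum (map f as) ⊑ sum (map g as)
sum-mono f⊑g []       = id
sum-mono {f = f} {g} f⊑g (a ∷ as) =
  +-mono {f a} {g a} {sum (map f as)} {sum (map g as)} (f⊑g a) (sum-mono f⊑g as)

∑-mono : ∀ {A : Set} (S : Pred A 0ℓ) {f g : A → [0,∞]} →
         (∀ a → f a ⊑ g a) → ∑ S f ⊑ ∑ S g
∑-mono S {f} {g} f⊑g =
  ⨆-mono {x = λ (as , _) → sum (map f as)} {λ (as , _) → sum (map g as)}
    λ (as , _) → sum-mono f⊑g as

module _ (𝓛 : Language) where
  open Language 𝓛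
  open pDL 𝓛

  -- For a fixed policy the paths and their probabilities do not depend on the reward, so the two
  -- sums compare term by term.
  𝐄-mono : ∀ σ {r r′ : State → [0,∞]} → (∀ τ → r τ ⊑ r′ τ) → 𝐄[ σ ] r ⊑ 𝐄[ σ ] r′
  𝐄-mono σ {r} {r′} r⊑r′ =
    ⨅-mono {x = λ π → 𝔼[ σ , π ] r} {λ π → 𝔼[ σ , π ] r′} λ π →
    ∑-mono (paths π σ) λ σs →
    *-monoʳ (Pr π σ σs) {r (final σ σs)} {r′ (final σ σs)} (r⊑r′ (final σ σs))

  -- Induction on the formula. Atoms are decidable, negations and boxes are negated statements (`≤`
  -- is one), and a double negation distributes over `×` and `∀` in the direction that is
  -- constructively valid.
  ⊨-stable : ∀ {Γ} ε (φ : Form Γ) ρ → Stable (ε ⊨ φ ⟨ ρ ⟩)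
  ⊨-stable ε (atom e)    ρ ¬¬h = decidable-stable (eval ε (e [ ρ ]) Bool.≟ _) ¬¬h
  ⊨-stable ε (∼ φ)       ρ ¬¬h h = ¬¬h λ ¬h → ¬h h
  ⊨-stable ε (φ ∧ ψ)     ρ ¬¬h =
    ⊨-stable ε φ ρ (λ ¬h → ¬¬h (¬h ∘ proj₁)) , ⊨-stable ε ψ ρ (λ ¬h → ¬¬h (¬h ∘ proj₂))
  ⊨-stable ε (all l φ)   ρ ¬¬h v v∈l =
    ⊨-stable ε φ _ λ ¬h → ¬¬h λ h → ¬h (h v v∈l)
  ⊨-stable ε ([ s ] p · φ) ρ ¬¬h h = ¬¬h λ ¬h → ¬h h

  ⇒-elim : ∀ {φ ψ : WellFormed} → ⊨ (φ ⇒ ψ) → ∀ ε → ε ⊨ φ → ε ⊨ ψ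
  ⇒-elim {ψ = ψ} φ⇒ψ ε h = ⊨-stable ε ψ _ λ ¬ψ → φ⇒ψ ε (h , ¬ψ)

  -- The common source of both weakenings of the postcondition. The implication is asked at every
  -- `ε′`, since the reward is evaluated at the final valuations rather than at `ε`.
  box-mono : ∀ ε s p {φ ψ : WellFormed} → (∀ ε′ → ε′ ⊨ φ → ε′ ⊨ ψ) →
             ε ⊨ [ s ] p · φ → ε ⊨ [ s ] p · ψ
  box-mono ε s p {φ} {ψ} φ→ψ h =
    ≤-trans-⊑ {proj₁ (p ε)} {𝐄[ σ ] r} {𝐄[ σ ] r′} h
      (𝐄-mono σ {r} {r′} λ (ε′ , _) → 𝟙-mono (φ→ψ ε′))
    where
    σ : State
    σ = ε , program s
    r r′ : State → [0,∞]
    r  (ε′ , _) = 𝟙 (ε′ ⊨ φ)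
    r′ (ε′ , _) = 𝟙 (ε′ ⊨ ψ)

proposition3 : (𝓛 : Language) → let open pDL 𝓛 in
    (ε : Valuation) (p p₁ p₂ : LowerBound) (s : TerminatingProgram)
    (φ φ₁ φ₂ : WellFormed) →
    (ε ⊨ [ s ] 𝟎 · φ)
    × (ε ⊨ [ s ] p₁ · φ → p₂ ≤ᵇ p₁ → ε ⊨ [ s ] p₂ · φ)
    × (ε ⊨ [ s ] p · (φ₁ ∧ φ₂) → (ε ⊨ [ s ] p · φ₁) × (ε ⊨ [ s ] p · φ₂))
    × (ε ⊨ [ s ] p · φ₁ → ⊨ (φ₁ ⇒ φ₂) → ε ⊨ [ s ] p · φ₂)
proposition3 𝓛 ε p p₁ p₂ s φ φ₁ φ₂ =
    0#-minimum (E φ)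
  -- Only the bound changes here; the expectation `E φ` stays fixed.
  , (λ h p₂≤p₁ → ≤-trans {proj₁ (p₂ ε)} {proj₁ (p₁ ε)} {E φ} (p₂≤p₁ ε) h)
  , (λ h → box-mono 𝓛 ε s p {φ₁ ∧ φ₂} {φ₁} (λ _ → proj₁) h
         , box-mono 𝓛 ε s p {φ₁ ∧ φ₂} {φ₂} (λ _ → proj₂) h)
  , (λ h φ₁⇒φ₂ → box-mono 𝓛 ε s p {φ₁} {φ₂} (⇒-elim 𝓛 {φ₁} {φ₂} φ₁⇒φ₂) h)
  where
  open pDL 𝓛
  E : WellFormed → [0,∞]
  E ψ = 𝐄[ ε , program s ] λ (ε′ , _) → 𝟙 (ε′ ⊨ ψ)
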